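{- There is a data structure that stores a dynamic finite set $S$ together with a function $f:S\to\mathbb{Z}_{\ge 0}$, supporting the updates (i) insert a new element $x$ with an arbitrary value $f(x)$, (ii) delete an element $x$, (iii) change $f(x)$ to an arbitrary new non-negative integer value for an element $x\in S$, and that after every update maintains the $h$-index of $S$ and $f$ together with an $h$-partition $(H,S\setminus H)$ of $S$ and $f$. Each update takes $O(1)$ time plus $O(1)$ dictionary operations (insert, delete, lookup in a dictionary keyed by elements of $S$ or by non-negative integers).
   Context: For a finite set $S$ and $f:S\to\mathbb{Z}_{\ge0}$, the $h$-index of $S$ and $f$ is the largest integer $h\ge 0$ such that there is a subset $H\subseteq S$ with $|H|=h$ and $f(x)\ge h$ for all $x\in H$. An $h$-partition of $S$ and $f$ is a partition $(H,S\setminus H)$ where $H$ is such a subset of maximum size, i.e. $|H|$ equals the $h$-index and $f(x)\ge |H|$ for all $x\in H$. -}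

module Defs where

open import Data.Bool using (Bool; if_then_else_)
open import Data.Fin using (Fin)
open import Data.List using (List; []; _∷_; length; filter)
open import Data.List.Membership.Propositional using (_∈_; _∉_)
open import Data.List.Relation.Binary.Subset.Propositional using (_⊆_)
open import Data.List.Relation.Unary.Unique.Propositional using (Unique)
open import Data.Maybe using (Maybe; just; nothing)
open import Data.Maybe.Properties using (≡-dec)
open import Data.Nat using (ℕ; suc; _+_; _∸_; _≤_; _≤ᵇ_)
import Data.Nat.Properties as ℕ
open import Data.Product using (_×_; _,_; ∃-syntax)
open import Data.Vec using (Vec; lookup; replicate; _[_]≔_)
open import Function using (_⇔_)
open import Relation.Binary.Definitions using (DecidableEquality)
open import Relation.Binary.PropositionalEquality using (_≡_; refl; cong)
open import Relation.Nullary using (no; does)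
open import Relation.Nullary.Decidable using (¬?; map′)

-- A finite set is a duplicate-free list S.  A function f : S → ℕ is given by
-- any extension to the ambient type U; nothing below depends on f outside S.

module _ {U : Set} where

  HasLargeSubset : List U → (U → ℕ) → ℕ → Set
  HasLargeSubset S f h =
    ∃[ H ] Unique H × H ⊆ S × length H ≡ h × (∀ {x} → x ∈ H → h ≤ f x)

  record IsHIndex (S : List U) (f : U → ℕ) (h : ℕ) : Set where
    field
      attained : HasLargeSubset S f h
      largest  : ∀ k → HasLargeSubset S f k → k ≤ h

  record IsHPartition (S : List U) (f : U → ℕ) (H K : List U) : Set where
    field
      H-unique     : Unique H
      H⊆S          : H ⊆ S
      H-size       : IsHIndex S f (length H)
      H-large      : ∀ {x} → x ∈ H → length H ≤ f x
      K-unique     : Unique K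
      K-complement : ∀ x → x ∈ K ⇔ (x ∈ S × x ∉ H)

-- Programs of a register machine with r registers and d dictionaries.
-- Programs are pure syntax: they contain no set elements and no host-language
-- functions, so elements can only be moved, compared for equality, and used in
-- dictionaries.

data Operand (r : ℕ) : Set where
  reg : Fin r → Operand r
  lit : ℕ → Operand r
  nil : Operand r

data BasicOp (r : ℕ) : Set where
  move : Fin r → Operand r → BasicOp r
  add  : Fin r → Operand r → Operand r → BasicOp r
  sub  : Fin r → Operand r → Operand r → BasicOp r

data DictOp (r d : ℕ) : Set where
  dinsert : Fin d → (key value : Operand r) → DictOp r d
  ddelete : Fin d → (key : Operand r) → DictOp r d
  dlookup : (target : Fin r) → Fin d → (key : Operand r) → DictOp r d

data Test (r : ℕ) : Set where
  equal : Operand r → Operand r → Test r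
  leq   : Operand r → Operand r → Test r

infixr 5 _⨾_

data Prog (r d : ℕ) : Set where
  skip  : Prog r d
  basic : BasicOp r → Prog r d
  dict  : DictOp r d → Prog r d
  _⨾_   : Prog r d → Prog r d → Prog r d
  cond  : Test r → Prog r d → Prog r d → Prog r d
  while : Test r → Prog r d → Prog r d

data Atom (U : Set) : Set where
  num : ℕ → Atom U
  el  : U → Atom U

-- `nothing` is the value nil.
Value : Set → Set
Value U = Maybe (Atom U)

-- `nothing` means that the key is absent, so looking up an absent key yields nil.
Dict : Set → Set
Dict U = Atom U → Value U

record State (U : Set) (r d : ℕ) : Set where
  constructor ⟨_,_⟩
  field
    regs  : Vec (Value U) r
    dicts : Vec (Dict U) d

open State public

blank : ∀ {U r d} → State U r d
blank = ⟨ replicate _ nothing , replicate _ (λ _ → nothing) ⟩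

module Semantics {U : Set} (_≟_ : DecidableEquality U) where

  _≟ᵃ_ : DecidableEquality (Atom U)
  num m ≟ᵃ num n = map′ (cong num) (λ { refl → refl }) (m ℕ.≟ n)
  num _ ≟ᵃ el _  = no λ ()
  el _  ≟ᵃ num _ = no λ ()
  el x  ≟ᵃ el y  = map′ (cong el) (λ { refl → refl }) (x ≟ y)

  _≟ᵛ_ : DecidableEquality (Value U)
  _≟ᵛ_ = ≡-dec _≟ᵃ_

  _⟦_⟧≔_ : Dict U → Atom U → Value U → Dict U
  (D ⟦ a ⟧≔ v) b = if does (a ≟ᵃ b) then v else D b

  module _ {r d : ℕ} where

    eval : State U r d → Operand r → Value U
    eval σ (reg i) = lookup (regs σ) i
    eval σ (lit n) = just (num n)
    eval σ nil     = nothing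

    setReg : State U r d → Fin r → Value U → State U r d
    setReg σ i v = ⟨ regs σ [ i ]≔ v , dicts σ ⟩

    setDict : State U r d → Fin d → Dict U → State U r d
    setDict σ j D = ⟨ regs σ , dicts σ [ j ]≔ D ⟩

    arith : State U r d → Fin r → (ℕ → ℕ → ℕ) → (v w : Value U) → Maybe (State U r d)
    arith σ i _·_ (just (num m)) (just (num n)) = just (setReg σ i (just (num (m · n))))
    arith σ i _·_ _              _              = nothing

    -- In `step`, `stepDict` and `test`, `nothing` is a run-time error (ill-typed
    -- operand); such a computation has no execution below.

    step : BasicOp r → State U r d → Maybe (State U r d)
    step (move i a)  σ = just (setReg σ i (eval σ a))
    step (add i a b) σ = arith σ i _+_ (eval σ a) (eval σ b)
    step (sub i a b) σ = arith σ i _∸_ (eval σ a) (eval σ b)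

    stepDict : DictOp r d → State U r d → Maybe (State U r d)
    stepDict (dinsert j k v) σ with eval σ k | eval σ v
    ... | just a | just b = just (setDict σ j (lookup (dicts σ) j ⟦ a ⟧≔ just b))
    ... | _      | _      = nothing
    stepDict (ddelete j k) σ with eval σ k
    ... | just a  = just (setDict σ j (lookup (dicts σ) j ⟦ a ⟧≔ nothing))
    ... | nothing = nothing
    stepDict (dlookup i j k) σ with eval σ k
    ... | just a  = just (setReg σ i (lookup (dicts σ) j a))
    ... | nothing = nothing

    test : Test r → State U r d → Maybe Bool
    test (equal a b) σ = just (does (eval σ a ≟ᵛ eval σ b))
    test (leq a b)   σ with eval σ a | eval σ b
    ... | just (num m) | just (num n) = just (m ≤ᵇ n)
    ... | _            | _            = nothing

    -- Exec p σ σ′ t q : started in σ, p halts in σ′ after t units of ordinary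
    -- time (basic operations and tests) and q dictionary operations.
    data Exec : Prog r d → State U r d → State U r d → ℕ → ℕ → Set where
      skip  : ∀ {σ} → Exec skip σ σ 0 0
      basic : ∀ {o σ σ′} → step o σ ≡ just σ′ → Exec (basic o) σ σ′ 1 0
      dict  : ∀ {o σ σ′} → stepDict o σ ≡ just σ′ → Exec (dict o) σ σ′ 0 1
      _⨾_   : ∀ {p p′ σ σ′ σ″ t t′ q q′} →
              Exec p σ σ′ t q → Exec p′ σ′ σ″ t′ q′ →
              Exec (p ⨾ p′) σ σ″ (t + t′) (q + q′)
      cond  : ∀ {b p p′ σ σ′ t q} (c : Test r) → test c σ ≡ just b →
              Exec (if b then p else p′) σ σ′ t q →
              Exec (cond c p p′) σ σ′ (suc t) q
      while : ∀ {b p σ σ′ t q} (c : Test r) → test c σ ≡ just b →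
              Exec (if b then p ⨾ while c p else skip) σ σ′ t q →
              Exec (while c p) σ σ′ (suc t) q

    just-unique : ∀ {A : Set} {m : Maybe A} {a b : A} → m ≡ just a → m ≡ just b → a ≡ b
    just-unique refl refl = refl

    Exec-deterministic : ∀ {p σ σ₁ σ₂ t₁ t₂ q₁ q₂} →
      Exec p σ σ₁ t₁ q₁ → Exec p σ σ₂ t₂ q₂ → σ₁ ≡ σ₂ × t₁ ≡ t₂ × q₁ ≡ q₂
    Exec-deterministic skip skip = refl , refl , refl
    Exec-deterministic (basic e) (basic e′) = just-unique e e′ , refl , refl
    Exec-deterministic (dict e) (dict e′) = just-unique e e′ , refl , refl
    Exec-deterministic (x ⨾ y) (x′ ⨾ y′) with Exec-deterministic x x′
    ... | refl , refl , refl with Exec-deterministic y y′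
    ...   | refl , refl , refl = refl , refl , refl
    Exec-deterministic (cond c e x) (cond .c e′ x′) with just-unique e e′
    ... | refl with Exec-deterministic x x′
    ...   | refl , refl , refl = refl , refl , refl
    Exec-deterministic (while c e x) (while .c e′ x′) with just-unique e e′
    ... | refl with Exec-deterministic x x′
    ...   | refl , refl , refl = refl , refl , refl

data Update (U : Set) : Set where
  insert : U → ℕ → Update U
  delete : U → Update U
  change : U → ℕ → Update U

Valid : {U : Set} → Update U → List U → Set
Valid (insert x _) S = x ∉ S
Valid (delete x)   S = x ∈ S
Valid (change x _) S = x ∈ S

module _ {U : Set} (_≟_ : DecidableEquality U) where

  updateSet : Update U → List U → List U
  updateSet (insert x _) S = x ∷ S
  updateSet (delete x)   S = filter (λ y → ¬? (x ≟ y)) S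
  updateSet (change _ _) S = S

  assign : U → ℕ → (U → ℕ) → (U → ℕ)
  assign x v f y = if does (x ≟ y) then v else f y

  updateFun : Update U → (U → ℕ) → (U → ℕ)
  updateFun (insert x v) f = assign x v f
  updateFun (delete _)   f = f
  updateFun (change x v) f = assign x v f

record DataStructure : Set where
  field
    #regs #dicts : ℕ
    -- An update's arguments are placed in the registers argX and argV.
    argX argV : Fin #regs
    -- Where the maintained output is stored between updates.
    outIndex : Fin #regs
    outH outRest : Fin #dicts
    initProg insertProg deleteProg changeProg : Prog #regs #dicts

module Behaviour (DS : DataStructure) {U : Set} (_≟_ : DecidableEquality U) where
  open DataStructure DS
  open Semantics _≟_

  DSState : Set
  DSState = State U #regs #dicts

  program : Update U → Prog #regs #dicts
  program (insert _ _) = insertProg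
  program (delete _)   = deleteProg
  program (change _ _) = changeProg

  load : Update U → DSState → DSState
  load (insert x v) σ = setReg (setReg σ argX (just (el x))) argV (just (num v))
  load (delete x)   σ = setReg σ argX (just (el x))
  load (change x v) σ = setReg (setReg σ argX (just (el x))) argV (just (num v))

  -- Reachable S f σ : some valid sequence of updates, starting from the empty
  -- set, leads to (S , f) and brings the machine to state σ.
  data Reachable : List U → (U → ℕ) → DSState → Set where
    start  : ∀ {f σ t q} → Exec initProg blank σ t q → Reachable [] f σ
    update : ∀ {S f σ σ′ t q} → Reachable S f σ →
             (u : Update U) → Valid u S →
             Exec (program u) (load u σ) σ′ t q →
             Reachable (updateSet _≟_ u S) (updateFun _≟_ u f) σ′

  HaltsWithin : ℕ → Prog #regs #dicts → DSState → Set
  HaltsWithin c p σ = ∃[ σ′ ] ∃[ t ] ∃[ q ] Exec p σ σ′ t q × t ≤ c × q ≤ c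

  HasKeys : Dict U → List U → Set
  HasKeys D L = ∀ a → (∃[ v ] D a ≡ just v) ⇔ (∃[ x ] a ≡ el x × x ∈ L)

  record StoresHPartition (S : List U) (f : U → ℕ) (σ : DSState) : Set where
    field
      h           : ℕ
      h-stored    : lookup (regs σ) outIndex ≡ just (num h)
      h-index     : IsHIndex S f h
      H K         : List U
      H-stored    : HasKeys (lookup (dicts σ) outH) H
      K-stored    : HasKeys (lookup (dicts σ) outRest) K
      h-partition : IsHPartition S f H K

  record MaintainsHPartition (c : ℕ) : Set where
    field
      initialises : HaltsWithin c initProg blank
      responds    : ∀ {S f σ} → Reachable S f σ → (u : Update U) → Valid u S →
                    HaltsWithin c (program u) (load u σ)
      correct     : ∀ {S f σ} → Reachable S f σ → StoresHPartition S f σ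

{-# OPTIONS --safe #-}
module Submission where

-- Keep H of size h so that H has only values ≥ h and S ∖ H only values ≤ h; then
-- a set of more than h elements with larger values would lie in H, so h is the
-- h-index.  Inserting into H, or deleting from H, is repaired by moving one
-- element of value h across the partition, and if there is none, then the
-- condition holds for h + 1, respectively h - 1.  Elements of value v in H and in
-- S ∖ H are kept in doubly linked lists, so that one of value h is found, and any
-- element is unlinked, with O(1) dictionary operations.

open import Defs
open import Data.Bool using (true; false; if_then_else_)
open import Data.Empty using (⊥)
open import Data.Fin using (Fin)
open import Data.Fin.Patterns using (0F; 1F; 2F; 3F; 4F; 5F; 6F; 7F)
open import Data.List using (List; []; _∷_; length; filter)
open import Data.List.Membership.Propositional using (_∈_; _∉_)
open import Data.List.Membership.Propositional.Properties using (∈-filter⁺; ∈-filter⁻)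
import Data.List.Membership.DecPropositional as DecMembership
open import Data.List.Relation.Binary.Subset.Propositional using (_⊆_)
open import Data.List.Relation.Unary.All as All using ()
open import Data.List.Relation.Unary.AllPairs using ([]; _∷_)
open import Data.List.Relation.Unary.Any using (here; there)
open import Data.List.Relation.Unary.Unique.Propositional using (Unique)
open import Data.List.Relation.Unary.Unique.Propositional.Properties using (filter⁺)
open import Data.Maybe as Maybe using (Maybe; just; nothing; maybe′)
open import Data.Maybe.Properties using (just-injective)
open import Data.Nat using (ℕ; zero; suc; _+_; _*_; _≤_; _<_; _≤ᵇ_; z≤n; s≤s)
open import Data.Nat.Properties as ℕ using (≤-refl; ≤-trans; ≤-reflexive; <-trans; <-irrefl)
open import Data.Product using (Σ-syntax; ∃-syntax; _×_; _,_; proj₁; proj₂)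
open import Data.Sum using (inj₁; inj₂)
open import Data.Vec using ([]; _∷_; lookup)
open import Function using (_∘_; _⇔_; mk⇔; Equivalence)
open import Relation.Binary.Definitions using (DecidableEquality)
open import Relation.Binary.PropositionalEquality using (_≡_; _≢_; refl; sym; trans; cong; subst)
open import Relation.Nullary using (¬_; ofʸ; ofⁿ; yes; no; does; contradiction)
open import Relation.Nullary.Decidable using (¬?; toSum)

-- The weak inequalities allow the value h on both sides. This slack is why one move per update
-- suffices: a borderline element fits wherever it is put. A change of value is a deletion followed
-- by an insertion, so two repairs cover all updates. The machine learns that no borderline element
-- exists only from an empty list header. That is a global fact about the links, whereas the
-- conditions maintained for them are local to a node; bridging this gap is the main work on the
-- lists. The argument about sizes and values never sees the links: it speaks of a ghost placement,
-- giving each element its side and value, which the dictionaries are required to represent. As the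
-- programs contain no loops, time bounds are read off from their syntax.

module _ {A : Set} where

  Unique-remove : ∀ {x : A} {xs} → Unique xs → x ∈ xs →
    ∃[ ys ] Unique ys × length xs ≡ suc (length ys) × (∀ {y} → y ∈ ys ⇔ (y ∈ xs × y ≢ x))
  Unique-remove {x} {_ ∷ xs} (x∉xs ∷ uniq) (here refl) =
    xs , uniq , refl , mk⇔ (λ y∈ → there y∈ , λ { refl → All.lookup x∉xs y∈ refl })
                           (λ { (here refl , y≢x) → contradiction refl y≢x ; (there y∈ , _) → y∈ })
  Unique-remove {x} {z ∷ xs} (z∉xs ∷ uniq) (there x∈xs) with Unique-remove uniq x∈xs
  ... | ys , uniq′ , len , mem =
    z ∷ ys
    , All.tabulate (λ y∈ → All.lookup z∉xs (proj₁ (to y∈))) ∷ uniq′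
    , cong suc len
    , mk⇔ (λ { (here refl) → here refl , All.lookup z∉xs x∈xs
             ; (there y∈) → there (proj₁ (to y∈)) , proj₂ (to y∈) })
          (λ { (here refl , _) → here refl ; (there y∈ , y≢x) → there (from (y∈ , y≢x)) })
    where
    to : ∀ {y} → y ∈ ys → y ∈ xs × y ≢ x
    to = Equivalence.to mem
    from : ∀ {y} → y ∈ xs × y ≢ x → y ∈ ys
    from = Equivalence.from mem

  -- Each element of `xs` is cancelled against its single occurrence in `ys`. This gives the
  -- maximality of the h-index, once a larger competing set is shown to lie inside H.
  Unique-⊆⇒length≤ : ∀ {xs ys : List A} → Unique xs → Unique ys → xs ⊆ ys → length xs ≤ length ys
  Unique-⊆⇒length≤ {[]}     _            _     _     = z≤n
  Unique-⊆⇒length≤ {x ∷ xs} (x∉xs ∷ uxs) uys xs⊆ys with Unique-remove uys (xs⊆ys (here refl))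
  ... | zs , uzs , len , mem = subst (suc (length xs) ≤_) (sym len)
    (s≤s (Unique-⊆⇒length≤ uxs uzs λ y∈ →
      Equivalence.from mem (xs⊆ys (there y∈) , λ { refl → All.lookup x∉xs y∈ refl })))

-- Pointwise updates of functions

module FunctionUpdate {A B : Set} (_≟_ : DecidableEquality A) where

  -- This has the same body as `_⟦_⟧≔_`; both unfold to the same term once applied, so the two
  -- lemmas below also serve for dictionaries.
  _[_↦_] : (A → B) → A → B → A → B
  (f [ x ↦ v ]) y = if does (x ≟ y) then v else f y

  update-at : ∀ f x {v} → (f [ x ↦ v ]) x ≡ v
  update-at f x with x ≟ x
  ... | yes _   = refl
  ... | no  x≢x = contradiction refl x≢x

  update-off : ∀ f {x y v} → x ≢ y → (f [ x ↦ v ]) y ≡ f y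
  update-off f {x} {y} x≢y with x ≟ y
  ... | yes x≡y = contradiction x≡y x≢y
  ... | no  _   = refl

nothing≢just : ∀ {A : Set} {m : Maybe A} {a} → m ≡ nothing → m ≢ just a
nothing≢just refl ()

el-injective : ∀ {U : Set} {x y : U} → _≡_ {A = Atom U} (el x) (el y) → x ≡ y
el-injective refl = refl

-- Doubly linked lists, one for each bucket number

module LinkedBuckets {U : Set} (_≟_ : DecidableEquality U) where
  open Semantics _≟_ using (_≟ᵃ_; _⟦_⟧≔_)
  open FunctionUpdate {B = Maybe ℕ} _≟_
  open FunctionUpdate {B = ℕ} _≟_ using ()
    renaming (_[_↦_] to _[_↦ˢ_]; update-at to stamp-at; update-off to stamp-off)
  open FunctionUpdate {B = Value U} _≟ᵃ_ using ()
    renaming (update-at to dict-at; update-off to dict-off)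

  bucketOf : (U → Maybe ℕ) → Atom U → Maybe ℕ
  bucketOf g (num n) = just n
  bucketOf g (el x)  = g x

  -- A header ranks above every stamp, so that the strict decrease in `Predecessor` also covers the
  -- step from a header to its first element.
  rank : (U → ℕ) → ℕ → Atom U → ℕ
  rank stamp clock (num _) = clock
  rank stamp clock (el x)  = stamp x

  bucketOf-off : ∀ g {x v a} → a ≢ el x → bucketOf (g [ x ↦ v ]) a ≡ bucketOf g a
  bucketOf-off g {a = num _} _   = refl
  bucketOf-off g {a = el _}  a≢x = update-off g λ { refl → a≢x refl }

  -- Bucket n is the null-terminated doubly linked list with header `num n`; g
  -- tells the bucket of an element.  These conditions are local to a node, except
  -- for the insertion times `stamp`: they decrease along a list, which excludes
  -- cycles detached from every header.
  Predecessor : (U → Maybe ℕ) → (next prev : Dict U) → (U → ℕ) → ℕ → U → ℕ → Set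
  Predecessor g next prev stamp clock y n =
    ∃[ a ] prev (el y) ≡ just a × next a ≡ just (el y) × bucketOf g a ≡ just n
           × stamp y < rank stamp clock a

  Successor : (U → Maybe ℕ) → (next prev : Dict U) → Atom U → Atom U → Set
  Successor g next prev a b =
    ∃[ y ] ∃[ n ] b ≡ el y × prev (el y) ≡ just a × g y ≡ just n × bucketOf g a ≡ just n

  record Linked (g : U → Maybe ℕ) (next prev : Dict U) : Set where
    field
      stamp       : U → ℕ
      clock       : ℕ
      stamp<      : ∀ y → stamp y < clock
      predecessor : ∀ {y n} → g y ≡ just n → Predecessor g next prev stamp clock y n
      successor   : ∀ {a b} → next a ≡ just b → Successor g next prev a b

  open Linked

  Linked-cong : ∀ {g g′ next prev} → (∀ y → g y ≡ g′ y) → Linked g next prev → Linked g′ next prev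
  Linked-cong {g} {g′} eq L = record
    { stamp = stamp L ; clock = clock L ; stamp< = stamp< L
    ; predecessor = λ {y} gy → let a , p , n , b , s = predecessor L (trans (eq y) gy)
                               in a , p , n , trans (sym (eq′ a)) b , s
    ; successor = λ {a} na → let y , n , e , p , gy , b = successor L na
                             in y , n , e , p , trans (sym (eq y)) gy , trans (sym (eq′ a)) b
    }
    where
    eq′ : ∀ a → bucketOf g a ≡ bucketOf g′ a
    eq′ (num _) = refl
    eq′ (el y)  = eq y

  empty-Linked : Linked (λ _ → nothing) (λ _ → nothing) (λ _ → nothing)
  empty-Linked = record
    -- `stamp<` ranges over absent elements as well, so the clock has to start above 0.
    { stamp = λ _ → 0 ; clock = 1 ; stamp< = λ _ → ≤-refl ; predecessor = λ () ; successor = λ () }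

  module _ {g : U → Maybe ℕ} {next prev : Dict U} (L : Linked g next prev) where

    -- A `next` entry would give `x` a bucket through `successor`. Hence linking into an empty
    -- bucket finds no stale forward pointer at the new element.
    absent-next : ∀ {x} → g x ≡ nothing → next (el x) ≡ nothing
    absent-next {x} gx with next (el x) in eq
    ... | nothing = refl
    ... | just _  = let _ , _ , _ , _ , _ , b = successor L eq in contradiction b (nothing≢just gx)

    -- Walking from `y` through predecessors raises the stamp, which stays below the clock, so the
    -- walk must reach the header, and then `next` is set there. This is what the stamps are for: a
    -- detached cycle would satisfy the other conditions while its header is empty.
    header-nonempty : ∀ {y n} → g y ≡ just n → next (num n) ≢ nothing
    header-nonempty {y} = climb (clock L) y (ℕ.m≤m+n (clock L) _)
      where
      -- `k` is fuel: at most `k` steps upwards are possible before the stamp would reach the clock.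
      climb : ∀ k y {n} → clock L ≤ k + stamp L y → g y ≡ just n → next (num n) ≢ nothing
      climb zero    y le gy eq = <-irrefl refl (≤-trans (stamp< L y) le)
      climb (suc k) y le gy eq with predecessor L gy
      ... | num _ , _ , n , refl , _ = nothing≢just eq n
      ... | el x  , _ , _ , b    , s =
        climb k x (≤-trans le (≤-trans (≤-reflexive (sym (ℕ.+-suc k _))) (ℕ.+-monoʳ-≤ k s))) b eq

    module Link {x : U} {n : ℕ} (gx : g x ≡ nothing) where

      private
        g′ : U → Maybe ℕ
        g′ = g [ x ↦ just n ]

        -- The new element enters at the front, so its stamp must exceed all others; the old clock
        -- does, and the clock then advances by one.
        stamp′ : U → ℕ
        stamp′ = stamp L [ x ↦ˢ clock L ]

        stamp′< : ∀ y → stamp′ y < suc (clock L)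
        stamp′< y with x ≟ y
        ... | yes _ = ≤-refl
        ... | no  _ = ℕ.m≤n⇒m≤1+n (stamp< L y)

        rank-mono : ∀ {a k} → a ≢ el x → k < rank (stamp L) (clock L) a → k < rank stamp′ (suc (clock L)) a
        rank-mono {num _} _   lt = ℕ.m≤n⇒m≤1+n lt
        rank-mono {el _}  a≢x lt = subst (_ <_) (sym (stamp-off (stamp L) λ { refl → a≢x refl })) lt

        next-x : next (el x) ≡ nothing
        next-x = absent-next gx

        ≢x : ∀ {a b} → next a ≡ just b → a ≢ el x
        ≢x na refl = nothing≢just next-x na

        g≢x : ∀ {y m} → g y ≡ just m → x ≢ y
        g≢x gy refl = nothing≢just gx gy

        gn : ∀ {y} → x ≢ y → g′ y ≡ g y
        gn = update-off g

      link-empty : next (num n) ≡ nothing →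
        Linked g′ (next ⟦ num n ⟧≔ just (el x)) (prev ⟦ el x ⟧≔ just (num n))
      link-empty nn = record
        { stamp = stamp′ ; clock = suc (clock L) ; stamp< = stamp′<
        ; predecessor = pred′ ; successor = succ′ }
        where
        pred′ : ∀ {y m} → g′ y ≡ just m →
          Predecessor g′ (next ⟦ num n ⟧≔ just (el x)) (prev ⟦ el x ⟧≔ just (num n)) stamp′ (suc (clock L)) y m
        pred′ {y} gy with toSum (x ≟ y)
        pred′ gy | inj₁ refl with trans (sym (update-at g x)) gy
        ... | refl = num n , dict-at prev (el x) , dict-at next (num n) , refl , stamp′< x
        pred′ {y} gy | inj₂ x≢y with predecessor L (trans (sym (update-off g x≢y)) gy)
        ... | a , p , na , b , s =
          a , trans (dict-off prev (x≢y ∘ el-injective)) p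
            , trans (dict-off next {num n} (λ { refl → nothing≢just nn na })) na
            , trans (bucketOf-off g (≢x na)) b
            , subst (_< _) (sym (stamp-off (stamp L) x≢y)) (rank-mono (≢x na) s)
        succ′ : ∀ {a b} → (next ⟦ num n ⟧≔ just (el x)) a ≡ just b →
          Successor g′ (next ⟦ num n ⟧≔ just (el x)) (prev ⟦ el x ⟧≔ just (num n)) a b
        succ′ {a} na with toSum (num n ≟ᵃ a)
        succ′ na | inj₁ refl with trans (sym (dict-at next (num n))) na
        ... | refl = x , n , refl , dict-at prev (el x) , update-at g x , refl
        succ′ {a} na′ | inj₂ n≢a with trans (sym (dict-off next n≢a)) na′
        ... | na with successor L na
        ...   | y , m , refl , p , gy , b =
          y , m , refl , trans (dict-off prev (g≢x gy ∘ el-injective)) p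
            , trans (gn (g≢x gy)) gy , trans (bucketOf-off g (≢x na)) b

      -- Only the header and the old first element `z` are affected besides `x`. That another node
      -- `y` differs from `z` is seen from its predecessor, because the one of `z` was the header.
      link-nonempty : ∀ {z} → next (num n) ≡ just (el z) →
        Linked g′ ((next ⟦ el x ⟧≔ just (el z)) ⟦ num n ⟧≔ just (el x))
                  ((prev ⟦ el z ⟧≔ just (el x)) ⟦ el x ⟧≔ just (num n))
      link-nonempty {z} nn with successor L nn
      ... | .z , .n , refl , pz , gz , refl = record
        { stamp = stamp′ ; clock = suc (clock L) ; stamp< = stamp′<
        ; predecessor = pred′ ; successor = succ′ }
        where
        prev₁ next₁ : Dict U
        prev₁ = prev ⟦ el z ⟧≔ just (el x)
        next₁ = next ⟦ el x ⟧≔ just (el z)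
        pred′ : ∀ {y m} → g′ y ≡ just m →
          Predecessor g′ (next₁ ⟦ num n ⟧≔ just (el x)) (prev₁ ⟦ el x ⟧≔ just (num n)) stamp′ (suc (clock L)) y m
        pred′ {y} gy with toSum (x ≟ y)
        pred′ gy | inj₁ refl with trans (sym (update-at g x)) gy
        ... | refl = num n , dict-at prev₁ (el x) , dict-at next₁ (num n) , refl , stamp′< x
        pred′ {y} gy | inj₂ x≢y with predecessor L (trans (sym (update-off g x≢y)) gy)
        ... | a , p , na , b , s with toSum (num n ≟ᵃ a)
        ...   | inj₂ n≢a =
          a , trans (dict-off prev₁ (x≢y ∘ el-injective))
                (trans (dict-off prev {el z} λ { refl → n≢a (just-injective (trans (sym pz) p)) }) p)
            , trans (dict-off next₁ n≢a) (trans (dict-off next (≢x na ∘ sym)) na)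
            , trans (bucketOf-off g (≢x na)) b
            , subst (_< _) (sym (stamp-off (stamp L) x≢y)) (rank-mono (≢x na) s)
        -- The old predecessor is the header, so `y` is `z`, and its predecessor becomes `x`, whose
        -- stamp is the old clock.
        pred′ {y} gy | inj₂ x≢y | _ , p , na , refl , s | inj₁ refl with trans (sym nn) na
        ...     | refl =
          el x , trans (dict-off prev₁ (x≢y ∘ el-injective)) (dict-at prev (el z))
               , dict-at next (el x)
               , update-at g x
               , subst (_< stamp′ x) (sym (stamp-off (stamp L) x≢y))
                   (subst (stamp L y <_) (sym (stamp-at (stamp L) x)) (stamp< L y))
        succ′ : ∀ {a b} → (next₁ ⟦ num n ⟧≔ just (el x)) a ≡ just b →
          Successor g′ (next₁ ⟦ num n ⟧≔ just (el x)) (prev₁ ⟦ el x ⟧≔ just (num n)) a b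
        succ′ {a} na with toSum (num n ≟ᵃ a)
        succ′ na | inj₁ refl with trans (sym (dict-at next₁ (num n))) na
        ... | refl = x , n , refl , dict-at prev₁ (el x) , update-at g x , refl
        succ′ {a} na | inj₂ n≢a with toSum (el x ≟ᵃ a)
        succ′ na | inj₂ n≢a | inj₁ refl
          with trans (sym (trans (dict-off next₁ {v = just (el x)} n≢a) (dict-at next (el x)))) na
        ... | refl =
          z , n , refl , trans (dict-off prev₁ (g≢x gz ∘ el-injective)) (dict-at prev (el z))
            , trans (gn (g≢x gz)) gz , update-at g x
        succ′ na′ | inj₂ n≢a | inj₂ x≢a with trans (sym (trans (dict-off next₁ n≢a) (dict-off next x≢a))) na′
        ... | na with successor L na
        ...   | y , m , refl , p , gy , b =
          y , m , refl
            , trans (dict-off prev₁ (g≢x gy ∘ el-injective))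
                (trans (dict-off prev {el z} λ { refl → n≢a (just-injective (trans (sym pz) p)) }) p)
            , trans (gn (g≢x gy)) gy , trans (bucketOf-off g (≢x na)) b

    module Unlink {x : U} {n : ℕ} {p : Atom U} (gx : g x ≡ just n) (px : prev (el x) ≡ just p) where

      private
        g′ : U → Maybe ℕ
        g′ = g [ x ↦ nothing ]

        next-p : next p ≡ just (el x)
        next-p with predecessor L gx
        ... | _ , p′ , na , _ , _ with trans (sym px) p′
        ... | refl = na

        bucket-p : bucketOf g p ≡ just n
        bucket-p with predecessor L gx
        ... | _ , p′ , _ , b , _ with trans (sym px) p′
        ... | refl = b

        rank-p : stamp L x < rank (stamp L) (clock L) p
        rank-p with predecessor L gx
        ... | _ , p′ , _ , _ , s with trans (sym px) p′
        ... | refl = s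

        -- Strictly decreasing stamps prevent a node from preceding itself.
        p≢x : p ≢ el x
        p≢x refl = <-irrefl refl rank-p

      -- The entry of `prev` at `x` stays behind: `Linked` constrains `prev` only at elements that
      -- have a bucket, and a later link overwrites it.
      unlink-last : next (el x) ≡ nothing → Linked g′ ((next ⟦ p ⟧≔ nothing) ⟦ el x ⟧≔ nothing) prev
      unlink-last nx = record
        { stamp = stamp L ; clock = clock L ; stamp< = stamp< L
        ; predecessor = pred′ ; successor = succ′ }
        where
        next₁ : Dict U
        next₁ = next ⟦ p ⟧≔ nothing
        pred′ : ∀ {y m} → g′ y ≡ just m →
          Predecessor g′ (next₁ ⟦ el x ⟧≔ nothing) prev (stamp L) (clock L) y m
        pred′ {y} gy with toSum (x ≟ y)
        pred′ gy | inj₁ refl = contradiction gy (nothing≢just (update-at g x))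
        pred′ gy | inj₂ x≢y with predecessor L (trans (sym (update-off g x≢y)) gy)
        ... | a , p′ , na , b , s =
          a , p′ , trans (dict-off next₁ (a≢x ∘ sym))
                     (trans (dict-off next {p} λ { refl → x≢y (el-injective (just-injective (trans (sym next-p) na))) }) na)
            , trans (bucketOf-off g a≢x) b , s
          where
          a≢x : a ≢ el x
          a≢x refl = nothing≢just nx na
        succ′ : ∀ {a b} → (next₁ ⟦ el x ⟧≔ nothing) a ≡ just b →
          Successor g′ (next₁ ⟦ el x ⟧≔ nothing) prev a b
        succ′ {a} na with toSum (el x ≟ᵃ a)
        succ′ na | inj₁ refl = contradiction na (nothing≢just (dict-at next₁ (el x)))
        succ′ {a} na | inj₂ x≢a with toSum (p ≟ᵃ a)
        succ′ na | inj₂ x≢a | inj₁ refl =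
          contradiction na (nothing≢just (trans (dict-off next₁ x≢a) (dict-at next p)))
        succ′ na | inj₂ x≢a | inj₂ p≢a
          with successor L (trans (sym (trans (dict-off next₁ x≢a) (dict-off next p≢a))) na)
        ... | y , m , refl , p′ , gy , b =
          y , m , refl , p′
            , trans (update-off g λ { refl → p≢a (just-injective (trans (sym px) p′)) }) gy
            , trans (bucketOf-off g (x≢a ∘ sym)) b

      -- The stamps are kept: a decreasing list stays decreasing when a node is left out, since the
      -- steps from `p` to `x` and from `x` to `z` compose.
      unlink-inner : ∀ {z} → next (el x) ≡ just (el z) →
        Linked g′ ((next ⟦ p ⟧≔ just (el z)) ⟦ el x ⟧≔ nothing) (prev ⟦ el z ⟧≔ just p)
      unlink-inner {z} nx with successor L nx
      ... | .z , m₀ , refl , pz , gz , bx with predecessor L gz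
      ...   | a₀ , pz′ , _ , _ , sz with trans (sym pz) pz′ | trans (sym gx) bx
      ...     | refl | refl = record
        { stamp = stamp L ; clock = clock L ; stamp< = stamp< L
        ; predecessor = pred′ ; successor = succ′ }
        where
        next₁ : Dict U
        next₁ = next ⟦ p ⟧≔ just (el z)
        bucket-p′ : bucketOf g′ p ≡ just n
        bucket-p′ = trans (bucketOf-off g p≢x) bucket-p
        x≢z : x ≢ z
        x≢z refl = <-irrefl refl sz
        pred′ : ∀ {y m} → g′ y ≡ just m →
          Predecessor g′ (next₁ ⟦ el x ⟧≔ nothing) (prev ⟦ el z ⟧≔ just p) (stamp L) (clock L) y m
        pred′ {y} gy with toSum (x ≟ y)
        pred′ gy | inj₁ refl = contradiction gy (nothing≢just (update-at g x))
        pred′ {y} gy | inj₂ x≢y with toSum (z ≟ y)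
        pred′ gy | inj₂ x≢y | inj₁ refl with trans (sym gz) (trans (sym (update-off g x≢y)) gy)
        ... | refl =
          p , dict-at prev (el z) , trans (dict-off next₁ (p≢x ∘ sym)) (dict-at next p)
            , bucket-p′ , <-trans sz rank-p
        pred′ gy | inj₂ x≢y | inj₂ z≢y with predecessor L (trans (sym (update-off g x≢y)) gy)
        ... | a , p′ , na , b , s =
          a , trans (dict-off prev (z≢y ∘ el-injective)) p′
            , trans (dict-off next₁ (a≢x ∘ sym))
                     (trans (dict-off next {p} λ { refl → x≢y (el-injective (just-injective (trans (sym next-p) na))) }) na)
            , trans (bucketOf-off g a≢x) b , s
          where
          a≢x : a ≢ el x
          a≢x refl = z≢y (el-injective (just-injective (trans (sym nx) na)))
        succ′ : ∀ {a b} → (next₁ ⟦ el x ⟧≔ nothing) a ≡ just b →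
          Successor g′ (next₁ ⟦ el x ⟧≔ nothing) (prev ⟦ el z ⟧≔ just p) a b
        succ′ {a} na with toSum (el x ≟ᵃ a)
        succ′ na | inj₁ refl = contradiction na (nothing≢just (dict-at next₁ (el x)))
        succ′ {a} na | inj₂ x≢a with toSum (p ≟ᵃ a)
        succ′ na | inj₂ x≢a | inj₁ refl with trans (sym (trans (dict-off next₁ x≢a) (dict-at next p))) na
        ... | refl =
          z , n , refl , dict-at prev (el z) , trans (update-off g x≢z) gz , bucket-p′
        succ′ na | inj₂ x≢a | inj₂ p≢a
          with successor L (trans (sym (trans (dict-off next₁ x≢a) (dict-off next p≢a))) na)
        ... | y , m , refl , p′ , gy , b =
          y , m , refl
            , trans (dict-off prev {el z} λ { refl → x≢a (just-injective (trans (sym pz) p′)) }) p′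
            , trans (update-off g λ { refl → p≢a (just-injective (trans (sym px) p′)) }) gy
            , trans (bucketOf-off g (x≢a ∘ sym)) b

-- Weakest preconditions and running time of loop-free programs

module WeakestPrecondition {U : Set} (_≟_ : DecidableEquality U) {r d : ℕ} where
  open Semantics _≟_

  -- Errors and loops get `⊥`, so a proof of `wp` includes termination. On a concrete program and an
  -- explicit register vector it reduces by computation up to the next undecided test, so single
  -- instructions need no rules.
  wp : Prog r d → (State U r d → Set) → State U r d → Set
  wp skip          Q σ = Q σ
  wp (basic o)     Q σ = maybe′ Q ⊥ (step o σ)
  wp (dict o)      Q σ = maybe′ Q ⊥ (stepDict o σ)
  wp (p ⨾ p′)      Q σ = wp p (wp p′ Q) σ
  wp (cond c p p′) Q σ = maybe′ (λ b → if b then wp p Q σ else wp p′ Q σ) ⊥ (test c σ)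
  wp (while _ _)   Q σ = ⊥

size : ∀ {r d} → Prog r d → ℕ
size skip          = 0
size (basic _)     = 1
size (dict _)      = 1
size (p ⨾ p′)      = size p + size p′
size (cond _ p p′) = suc (size p + size p′)
size (while _ p)   = suc (size p)

module _ {U : Set} (_≟_ : DecidableEquality U) {r d : ℕ} where
  open Semantics _≟_
  open WeakestPrecondition _≟_ {r} {d}

  -- No loop is ever entered, so each instruction runs at most once, and one number bounds both
  -- kinds of cost.
  wp-sound : ∀ p {Q σ} → wp p Q σ →
    ∃[ σ′ ] ∃[ t ] ∃[ q ] Exec p σ σ′ t q × t ≤ size p × q ≤ size p × Q σ′
  wp-sound skip w = _ , _ , _ , skip , z≤n , z≤n , w
  wp-sound (basic o) {σ = σ} w with step o σ in eq
  ... | just _ = _ , _ , _ , basic eq , ≤-refl , z≤n , w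
  wp-sound (dict o) {σ = σ} w with stepDict o σ in eq
  ... | just _ = _ , _ , _ , dict eq , z≤n , ≤-refl , w
  wp-sound (p ⨾ p′) w with wp-sound p w
  ... | _ , _ , _ , x , t≤ , q≤ , w′ with wp-sound p′ w′
  ...   | _ , _ , _ , x′ , t′≤ , q′≤ , w″ =
    _ , _ , _ , x ⨾ x′ , ℕ.+-mono-≤ t≤ t′≤ , ℕ.+-mono-≤ q≤ q′≤ , w″
  wp-sound (cond c p p′) {σ = σ} w with test c σ in eq
  ... | just true with wp-sound p w
  ...   | _ , _ , _ , x , t≤ , q≤ , w′ =
    _ , _ , _ , cond c eq x , s≤s (ℕ.m≤n⇒m≤n+o _ t≤) , ℕ.m≤n⇒m≤1+n (ℕ.m≤n⇒m≤n+o _ q≤) , w′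
  wp-sound (cond c p p′) {σ = σ} w | just false with wp-sound p′ w
  ...   | _ , _ , _ , x , t≤ , q≤ , w′ =
    _ , _ , _ , cond c eq x , s≤s (ℕ.m≤n⇒m≤o+n _ t≤) , ℕ.m≤n⇒m≤1+n (ℕ.m≤n⇒m≤o+n _ q≤) , w′

-- Sides and values of the elements, and the number of high elements

data Side : Set where
  high low : Side

Place : Set
Place = Maybe (Side × ℕ)

-- Even numbers serve the high side and odd ones the low side, so all lists share one pair of link
-- dictionaries, and additions alone find the header.
bucketNumber : Side × ℕ → ℕ
bucketNumber (high , v) = v + v
bucketNumber (low  , v) = v + v + 1

double-injective : ∀ m n → m + m ≡ n + n → m ≡ n
double-injective m n eq = ℕ.*-cancelʳ-≡ m n 2 (trans (m*2 m) (trans eq (sym (m*2 n))))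
  where
  m*2 : ∀ k → k * 2 ≡ k + k
  m*2 k = trans (ℕ.*-comm k 2) (cong (k +_) (ℕ.+-identityʳ k))

double≢double+1 : ∀ m n → m + m ≢ n + n + 1
double≢double+1 m n eq = ℕ.even≢odd m n
  (trans (cong (m +_) (ℕ.+-identityʳ m))
    (trans eq (trans (ℕ.+-comm (n + n) 1) (cong (λ k → suc (n + k)) (sym (ℕ.+-identityʳ n))))))

bucketNumber-injective : ∀ {a b} → bucketNumber a ≡ bucketNumber b → a ≡ b
bucketNumber-injective {high , m} {high , n} eq = cong (high ,_) (double-injective m n eq)
bucketNumber-injective {high , m} {low  , n} eq = contradiction eq (double≢double+1 m n)
bucketNumber-injective {low  , m} {high , n} eq = contradiction (sym eq) (double≢double+1 n m)
bucketNumber-injective {low  , m} {low  , n} eq = cong (low ,_) (double-injective m n (ℕ.+-cancelʳ-≡ 1 _ _ eq))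

map-bucketNumber-injective : ∀ {p a} → Maybe.map bucketNumber p ≡ just (bucketNumber a) → p ≡ just a
map-bucketNumber-injective {just _} eq = cong just (bucketNumber-injective (just-injective eq))

Fits : ℕ → Side → ℕ → Set
Fits h high v = h ≤ v
Fits h low  v = v ≤ h

IsHigh : Place → Set
IsHigh p = ∃[ v ] p ≡ just (high , v)

module Placement {U : Set} (_≟_ : DecidableEquality U) where
  open FunctionUpdate {B = Place} _≟_
  open FunctionUpdate {B = Maybe ℕ} _≟_ using () renaming (_[_↦_] to _[_↦ᵐ_])

  Agrees : (U → Maybe ℕ) → (U → Place) → Set
  Agrees m c = ∀ y → Maybe.map proj₂ (c y) ≡ m y

  HighCount : (U → Place) → ℕ → Set
  HighCount c k = ∃[ L ] Unique L × length L ≡ k × (∀ {y} → y ∈ L ⇔ IsHigh (c y))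

  Bounded : (U → Place) → ℕ → Set
  Bounded c h = ∀ y {s v} → c y ≡ just (s , v) → Fits h s v

  Agrees-update : ∀ m c {x p} → Agrees m c → Agrees (m [ x ↦ᵐ Maybe.map proj₂ p ]) (c [ x ↦ p ])
  Agrees-update m c {x = x} ag y with x ≟ y
  ... | yes _ = refl
  ... | no  _ = ag y

  Agrees-move : ∀ m c {x s t v} → Agrees m c → c x ≡ just (s , v) →
    Agrees m ((c [ x ↦ nothing ]) [ x ↦ just (t , v) ])
  Agrees-move m c {x = x} ag cx y with x ≟ y
  ... | yes refl = trans (cong (Maybe.map proj₂) (sym cx)) (ag x)
  ... | no  _    = ag y

  Agrees-absent : ∀ m c {x} → Agrees m c → m x ≡ nothing → c x ≡ nothing
  Agrees-absent m c {x} ag mx with c x | ag x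
  ... | nothing | _  = refl
  ... | just _  | eq = contradiction (sym eq) (nothing≢just mx)

  Bounded-put : ∀ c {h x s v} → Bounded c h → Fits h s v → Bounded (c [ x ↦ just (s , v) ]) h
  Bounded-put c {x = x} bd fits y eq with x ≟ y
  Bounded-put c bd fits y refl | yes _ = fits
  Bounded-put c bd fits y eq   | no  _ = bd y eq

  Bounded-drop : ∀ c {h x} → Bounded c h → Bounded (c [ x ↦ nothing ]) h
  Bounded-drop c {x = x} bd y eq with x ≟ y
  Bounded-drop c bd y () | yes _
  Bounded-drop c bd y eq | no  _ = bd y eq

  Bounded-suc : ∀ c {h} → Bounded c h → (∀ y → c y ≢ just (high , h)) → Bounded c (suc h)
  Bounded-suc c bd none y {high} cy = ℕ.≤∧≢⇒< (bd y cy) λ { refl → none y cy }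
  Bounded-suc c bd none y {low}  cy = ℕ.m≤n⇒m≤1+n (bd y cy)

  Bounded-pred : ∀ c {h} → Bounded c (suc h) → (∀ y → c y ≢ just (low , suc h)) → Bounded c h
  Bounded-pred c bd none y {high} cy = ≤-trans (ℕ.n≤1+n _) (bd y cy)
  Bounded-pred c bd none y {low}  cy = ℕ.≤-pred (ℕ.≤∧≢⇒< (bd y cy) λ { refl → none y cy })

  HighCount-same : ∀ c {k x p} → ¬ IsHigh (c x) → ¬ IsHigh p → HighCount c k → HighCount (c [ x ↦ p ]) k
  HighCount-same c {k} {x} {p} ¬cx ¬p (L , uniq , len , mem) = L , uniq , len , mk⇔ to from
    where
    to : ∀ {y} → y ∈ L → IsHigh ((c [ x ↦ p ]) y)
    to {y} y∈ with x ≟ y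
    ... | yes refl = contradiction (Equivalence.to mem y∈) ¬cx
    ... | no  _    = Equivalence.to mem y∈
    from : ∀ {y} → IsHigh ((c [ x ↦ p ]) y) → y ∈ L
    from {y} hi with x ≟ y
    ... | yes _ = contradiction hi ¬p
    ... | no  _ = Equivalence.from mem hi

  HighCount-put : ∀ c {k x v} → ¬ IsHigh (c x) → HighCount c k → HighCount (c [ x ↦ just (high , v) ]) (suc k)
  HighCount-put c {k} {x} {v} ¬cx (L , uniq , len , mem) =
    x ∷ L
    , All.tabulate (λ { y∈ refl → ¬cx (Equivalence.to mem y∈) }) ∷ uniq
    , cong suc len , mk⇔ to from
    where
    to : ∀ {y} → y ∈ x ∷ L → IsHigh ((c [ x ↦ just (high , v) ]) y)
    to {y} y∈ with x ≟ y
    to y∈          | yes refl = v , refl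
    to (here refl) | no  x≢x  = contradiction refl x≢x
    to (there y∈)  | no  _    = Equivalence.to mem y∈
    from : ∀ {y} → IsHigh ((c [ x ↦ just (high , v) ]) y) → y ∈ x ∷ L
    from {y} hi with x ≟ y
    ... | yes refl = here refl
    ... | no  _    = there (Equivalence.from mem hi)

  HighCount-drop : ∀ c {k x} → IsHigh (c x) → HighCount c k →
    ∃[ k′ ] k ≡ suc k′ × HighCount (c [ x ↦ nothing ]) k′
  HighCount-drop c {k} {x} cx (L , uniq , refl , mem) with Unique-remove uniq (Equivalence.from mem cx)
  ... | L′ , uniq′ , len , mem′ = length L′ , len , L′ , uniq′ , refl , mk⇔ to from
    where
    to : ∀ {y} → y ∈ L′ → IsHigh ((c [ x ↦ nothing ]) y)
    to {y} y∈ with x ≟ y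
    ... | yes refl = contradiction refl (proj₂ (Equivalence.to mem′ y∈))
    ... | no  _    = Equivalence.to mem (proj₁ (Equivalence.to mem′ y∈))
    from : ∀ {y} → IsHigh ((c [ x ↦ nothing ]) y) → y ∈ L′
    from {y} hi with x ≟ y
    from (_ , ()) | yes _
    from hi       | no  x≢y = Equivalence.from mem′ (Equivalence.from mem hi , x≢y ∘ sym)

-- The dictionaries of the two sides map the elements of H (high) and of S ∖ H
-- (low) to their values.
Program : Set
Program = Prog 8 4

argXʳ argVʳ indexʳ elemʳ valueʳ bucketʳ predʳ succʳ : Fin 8
argXʳ   = 0F
argVʳ   = 1F
indexʳ  = 2F
elemʳ   = 3F
valueʳ  = 4F
bucketʳ = 5F
predʳ   = 6F
succʳ   = 7F

sideᵈ : Side → Fin 4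
sideᵈ high = 0F
sideᵈ low  = 1F

nextᵈ prevᵈ : Fin 4
nextᵈ = 2F
prevᵈ = 3F

link unlink : Program
link =
  dict (dlookup succʳ nextᵈ (reg bucketʳ)) ⨾
  cond (equal (reg succʳ) nil) skip
    (dict (dinsert prevᵈ (reg succʳ) (reg elemʳ)) ⨾
     dict (dinsert nextᵈ (reg elemʳ) (reg succʳ))) ⨾
  dict (dinsert nextᵈ (reg bucketʳ) (reg elemʳ)) ⨾
  dict (dinsert prevᵈ (reg elemʳ) (reg bucketʳ))
unlink =
  dict (dlookup predʳ prevᵈ (reg elemʳ)) ⨾
  dict (dlookup succʳ nextᵈ (reg elemʳ)) ⨾
  cond (equal (reg succʳ) nil)
    (dict (ddelete nextᵈ (reg predʳ)))
    (dict (dinsert nextᵈ (reg predʳ) (reg succʳ)) ⨾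
     dict (dinsert prevᵈ (reg succʳ) (reg predʳ))) ⨾
  dict (ddelete nextᵈ (reg elemʳ))

loadBucket : Side → Fin 8 → Program
loadBucket high i = basic (add bucketʳ (reg i) (reg i))
loadBucket low  i = basic (add bucketʳ (reg i) (reg i)) ⨾ basic (add bucketʳ (reg bucketʳ) (lit 1))

put take : Side → Program
put s  = dict (dinsert (sideᵈ s) (reg elemʳ) (reg valueʳ)) ⨾ loadBucket s valueʳ ⨾ link
take s = dict (ddelete (sideᵈ s) (reg elemʳ)) ⨾ unlink

findBorderline : Side → Program
findBorderline s = loadBucket s indexʳ ⨾ dict (dlookup elemʳ nextᵈ (reg bucketʳ))

shrink grow addProg removeProg : Program
shrink = cond (equal (reg elemʳ) nil)
  (basic (add indexʳ (reg indexʳ) (lit 1)))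
  (take high ⨾ basic (move valueʳ (reg indexʳ)) ⨾ put low)
grow = cond (equal (reg elemʳ) nil)
  (basic (sub indexʳ (reg indexʳ) (lit 1)))
  (take low ⨾ basic (move valueʳ (reg indexʳ)) ⨾ put high)
addProg =
  basic (move elemʳ (reg argXʳ)) ⨾ basic (move valueʳ (reg argVʳ)) ⨾
  cond (leq (reg valueʳ) (reg indexʳ)) (put low)
    (put high ⨾ findBorderline high ⨾ shrink)
removeProg =
  basic (move elemʳ (reg argXʳ)) ⨾ dict (dlookup valueʳ (sideᵈ high) (reg elemʳ)) ⨾
  cond (equal (reg valueʳ) nil) (take low)
    (take high ⨾ findBorderline low ⨾ grow)

entry : ∀ {U} → Side → Place → Value U
entry high (just (high , v)) = just (num v)
entry low  (just (low  , v)) = just (num v)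
entry _    _                 = nothing

module Correctness {U : Set} (_≟_ : DecidableEquality U) where
  open Semantics _≟_ using (_⟦_⟧≔_)
  open WeakestPrecondition _≟_ {8} {4}
  open LinkedBuckets _≟_
  open Linked
  open Placement _≟_
  open FunctionUpdate {B = Place} _≟_
  open FunctionUpdate {B = Maybe ℕ} _≟_ using () renaming (_[_↦_] to _[_↦ᵐ_])

  Machine : Set
  Machine = State U 8 4

  link-spec : ∀ {Q : Machine → Set} {rX rV rI rW rP rS DH DK next prev g x n} →
    Linked g next prev → g x ≡ nothing →
    (∀ {rS′ next′ prev′} → Linked (λ y → if does (x ≟ y) then just n else g y) next′ prev′ →
      Q ⟨ rX ∷ rV ∷ rI ∷ just (el x) ∷ rW ∷ just (num n) ∷ rP ∷ rS′ ∷ [] , DH ∷ DK ∷ next′ ∷ prev′ ∷ [] ⟩) →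
    wp link Q ⟨ rX ∷ rV ∷ rI ∷ just (el x) ∷ rW ∷ just (num n) ∷ rP ∷ rS ∷ [] , DH ∷ DK ∷ next ∷ prev ∷ [] ⟩
  link-spec {next = next} {n = n} L gx k with next (num n) in eq
  ... | nothing = k (Link.link-empty L gx eq)
  ... | just _ with successor L eq
  ...   | _ , _ , refl , _ = k (Link.link-nonempty L gx eq)

  unlink-spec : ∀ {Q : Machine → Set} {rX rV rI rW rB rP rS DH DK next prev g x n} →
    Linked g next prev → g x ≡ just n →
    (∀ {rP′ rS′ next′ prev′} → Linked (λ y → if does (x ≟ y) then nothing else g y) next′ prev′ →
      Q ⟨ rX ∷ rV ∷ rI ∷ just (el x) ∷ rW ∷ rB ∷ rP′ ∷ rS′ ∷ [] , DH ∷ DK ∷ next′ ∷ prev′ ∷ [] ⟩) →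
    wp unlink Q ⟨ rX ∷ rV ∷ rI ∷ just (el x) ∷ rW ∷ rB ∷ rP ∷ rS ∷ [] , DH ∷ DK ∷ next ∷ prev ∷ [] ⟩
  unlink-spec {next = next} {prev} {x = x} L gx k with prev (el x) in px | predecessor L gx
  ... | just _ | _ with next (el x) in nx
  ...   | nothing = k (Unlink.unlink-last L gx px nx)
  ...   | just _ with successor L nx
  ...     | _ , _ , refl , _ = k (Unlink.unlink-inner L gx px nx)

  record Represents (c : U → Place) (D : Side → Dict U) (next prev : Dict U) : Set where
    field
      stores : ∀ s y → D s (el y) ≡ entry s (c y)
      no-num : ∀ s n → D s (num n) ≡ nothing
      linked : Linked (Maybe.map bucketNumber ∘ c) next prev

  open Represents

  replace : Side → Dict U → (Side → Dict U) → Side → Dict U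
  replace high E D high = E
  replace high E D low  = D low
  replace low  E D high = D high
  replace low  E D low  = E

  Represents-update : ∀ {c D next prev next′ prev′ x} s p {v} → Represents c D next prev →
    entry s p ≡ v → (∀ t → t ≢ s → entry {U} t p ≡ entry t (c x)) →
    Linked (λ y → if does (x ≟ y) then Maybe.map bucketNumber p else Maybe.map bucketNumber (c y)) next′ prev′ →
    Represents (c [ x ↦ p ]) (replace s (D s ⟦ el x ⟧≔ v) D) next′ prev′
  Represents-update {c} {D} {x = x} s p {v} R same other L = record
    { stores = stores′ s same other
    ; no-num = no-num′ s
    ; linked = Linked-cong linked′ L
    }
    where
    here′ : ∀ s → entry s p ≡ v → ∀ y → (D s ⟦ el x ⟧≔ v) (el y) ≡ entry s ((c [ x ↦ p ]) y)
    here′ s same y with x ≟ y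
    ... | yes _ = sym same
    ... | no  _ = stores R s y
    there′ : ∀ t → entry {U} t p ≡ entry t (c x) → ∀ y → D t (el y) ≡ entry t ((c [ x ↦ p ]) y)
    there′ t eq y with x ≟ y
    ... | yes refl = trans (stores R t x) (sym eq)
    ... | no  _    = stores R t y
    stores′ : ∀ s → entry s p ≡ v → (∀ t → t ≢ s → entry {U} t p ≡ entry t (c x)) →
      ∀ t y → replace s (D s ⟦ el x ⟧≔ v) D t (el y) ≡ entry t ((c [ x ↦ p ]) y)
    stores′ high same other high = here′ high same
    stores′ high same other low  = there′ low (other low λ ())
    stores′ low  same other high = there′ high (other high λ ())
    stores′ low  same other low  = here′ low same
    no-num′ : ∀ s t n → replace s (D s ⟦ el x ⟧≔ v) D t (num n) ≡ nothing
    no-num′ high high = no-num R high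
    no-num′ high low  = no-num R low
    no-num′ low  high = no-num R high
    no-num′ low  low  = no-num R low
    linked′ : ∀ y → (if does (x ≟ y) then Maybe.map bucketNumber p else Maybe.map bucketNumber (c y))
      ≡ Maybe.map bucketNumber ((c [ x ↦ p ]) y)
    linked′ y with x ≟ y
    ... | yes _ = refl
    ... | no  _ = refl

  entry-other : ∀ s t v → t ≢ s → entry {U} t (just (s , v)) ≡ entry t nothing
  entry-other high high v t≢s = contradiction refl t≢s
  entry-other high low  v _   = refl
  entry-other low  high v _   = refl
  entry-other low  low  v t≢s = contradiction refl t≢s

  -- A register that a program overwrites does not occur in its computed wp, so
  -- specifications are applied below with `nothing` for its old content.
  put-spec : ∀ s {Q : Machine → Set} {rX rV rI rB rP rS D next prev c x v} →
    Represents c D next prev → c x ≡ nothing →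
    (∀ {rB′ rS′ D′ next′ prev′} → Represents (c [ x ↦ just (s , v) ]) D′ next′ prev′ →
      Q ⟨ rX ∷ rV ∷ rI ∷ just (el x) ∷ just (num v) ∷ rB′ ∷ rP ∷ rS′ ∷ []
        , D′ high ∷ D′ low ∷ next′ ∷ prev′ ∷ [] ⟩) →
    wp (put s) Q ⟨ rX ∷ rV ∷ rI ∷ just (el x) ∷ just (num v) ∷ rB ∷ rP ∷ rS ∷ []
                 , D high ∷ D low ∷ next ∷ prev ∷ [] ⟩
  put-spec high {Q} {v = v} R cx k =
    link-spec {Q} {rS = nothing} (linked R) (cong (Maybe.map bucketNumber) cx) λ L →
      k (Represents-update high (just (high , v)) R refl
           (λ t t≢s → trans (entry-other high t v t≢s) (cong (entry t) (sym cx))) L)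
  put-spec low {Q} {v = v} R cx k =
    link-spec {Q} {rS = nothing} (linked R) (cong (Maybe.map bucketNumber) cx) λ L →
      k (Represents-update low (just (low , v)) R refl
           (λ t t≢s → trans (entry-other low t v t≢s) (cong (entry t) (sym cx))) L)

  take-spec : ∀ s {Q : Machine → Set} {rX rV rI rW rB rP rS D next prev c x v} →
    Represents c D next prev → c x ≡ just (s , v) →
    (∀ {rP′ rS′ D′ next′ prev′} → Represents (c [ x ↦ nothing ]) D′ next′ prev′ →
      Q ⟨ rX ∷ rV ∷ rI ∷ just (el x) ∷ rW ∷ rB ∷ rP′ ∷ rS′ ∷ []
        , D′ high ∷ D′ low ∷ next′ ∷ prev′ ∷ [] ⟩) →
    wp (take s) Q ⟨ rX ∷ rV ∷ rI ∷ just (el x) ∷ rW ∷ rB ∷ rP ∷ rS ∷ []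
                  , D high ∷ D low ∷ next ∷ prev ∷ [] ⟩
  take-spec high {Q} {v = v} R cx k =
    unlink-spec {Q} {rP = nothing} {rS = nothing} (linked R) (cong (Maybe.map bucketNumber) cx) λ L →
      k (Represents-update high nothing R refl
           (λ t t≢s → trans (sym (entry-other high t v t≢s)) (cong (entry t) (sym cx))) L)
  take-spec low {Q} {v = v} R cx k =
    unlink-spec {Q} {rP = nothing} {rS = nothing} (linked R) (cong (Maybe.map bucketNumber) cx) λ L →
      k (Represents-update low nothing R refl
           (λ t t≢s → trans (sym (entry-other low t v t≢s)) (cong (entry t) (sym cx))) L)

  findBorderline-spec : ∀ s {Q : Machine → Set} {rX rV h rE rW rB rP rS D next prev c} →
    Represents c D next prev →
    (∀ {rB′} → (∀ y → c y ≢ just (s , h)) →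
      Q ⟨ rX ∷ rV ∷ just (num h) ∷ nothing ∷ rW ∷ rB′ ∷ rP ∷ rS ∷ []
        , D high ∷ D low ∷ next ∷ prev ∷ [] ⟩) →
    (∀ {rB′} y → c y ≡ just (s , h) →
      Q ⟨ rX ∷ rV ∷ just (num h) ∷ just (el y) ∷ rW ∷ rB′ ∷ rP ∷ rS ∷ []
        , D high ∷ D low ∷ next ∷ prev ∷ [] ⟩) →
    wp (findBorderline s) Q ⟨ rX ∷ rV ∷ just (num h) ∷ rE ∷ rW ∷ rB ∷ rP ∷ rS ∷ []
                            , D high ∷ D low ∷ next ∷ prev ∷ [] ⟩
  findBorderline-spec s {h = h} {next = next} R none some with next (num (bucketNumber (s , h))) in eq
  findBorderline-spec high R none some | nothing rewrite eq =
    none λ y cy → header-nonempty (linked R) (cong (Maybe.map bucketNumber) cy) eq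
  findBorderline-spec low R none some | nothing rewrite eq =
    none λ y cy → header-nonempty (linked R) (cong (Maybe.map bucketNumber) cy) eq
  findBorderline-spec s R none some | just _ with successor (linked R) eq
  findBorderline-spec high R none some | just _ | y , _ , refl , _ , gy , refl rewrite eq =
    some y (map-bucketNumber-injective gy)
  findBorderline-spec low R none some | just _ | y , _ , refl , _ , gy , refl rewrite eq =
    some y (map-bucketNumber-injective gy)

  record Consistent (m : U → Maybe ℕ) (σ : Machine) : Set where
    field
      h           : ℕ
      c           : U → Place
      index       : lookup (regs σ) indexʳ ≡ just (num h)
      agrees      : Agrees m c
      highCount   : HighCount c h
      bounded     : Bounded c h
      represents  : Represents c (λ s → lookup (dicts σ) (sideᵈ s))
                      (lookup (dicts σ) nextᵈ) (lookup (dicts σ) prevᵈ)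

  open Consistent

  consistent : ∀ {m c h D next prev rX rV rE rW rB rP rS} →
    Agrees m c → HighCount c h → Bounded c h → Represents c D next prev →
    Consistent m ⟨ rX ∷ rV ∷ just (num h) ∷ rE ∷ rW ∷ rB ∷ rP ∷ rS ∷ [] , D high ∷ D low ∷ next ∷ prev ∷ [] ⟩
  consistent ag hc bd R = record
    { index = refl ; agrees = ag ; highCount = hc ; bounded = bd
    ; represents = record
      { stores = λ { high → stores R high ; low → stores R low }
      ; no-num = λ { high → no-num R high ; low → no-num R low }
      ; linked = linked R
      }
    }

  reload : ∀ {m rX rV rX′ rV′ rI rE rW rB rP rS ds} →
    Consistent m ⟨ rX ∷ rV ∷ rI ∷ rE ∷ rW ∷ rB ∷ rP ∷ rS ∷ [] , ds ⟩ →
    Consistent m ⟨ rX′ ∷ rV′ ∷ rI ∷ rE ∷ rW ∷ rB ∷ rP ∷ rS ∷ [] , ds ⟩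
  reload C = record
    { index = index C ; agrees = agrees C ; highCount = highCount C
    ; bounded = bounded C ; represents = represents C }

  ¬high-nothing : ∀ {p} → p ≡ nothing → ¬ IsHigh p
  ¬high-nothing refl (_ , ())

  ¬high-low : ∀ {p v} → p ≡ just (low , v) → ¬ IsHigh p
  ¬high-low refl (_ , ())

  add-spec : ∀ {Q : Machine → Set} {rI rE rW rB rP rS ds m x v} →
    let σ = ⟨ just (el x) ∷ just (num v) ∷ rI ∷ rE ∷ rW ∷ rB ∷ rP ∷ rS ∷ [] , ds ⟩ in
    Consistent m σ → m x ≡ nothing →
    (∀ {σ′} → Consistent (m [ x ↦ᵐ just v ]) σ′ → Q σ′) →
    wp addProg Q σ
  add-spec {Q} {ds = _ ∷ _ ∷ _ ∷ _ ∷ []} {m = m} {x} {v} record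
    { h = h ; c = c ; index = refl ; agrees = ag ; highCount = hc ; bounded = bd ; represents = R } mx k
    with v ≤ᵇ h | ℕ.≤ᵇ-reflects-≤ v h
  ... | true | ofʸ v≤h =
    put-spec low {Q} {rB = nothing} {rS = nothing} R cx λ R′ → k (consistent
      (Agrees-update m c ag) (HighCount-same c (¬high-nothing cx) (¬high-low refl) hc) (Bounded-put c bd v≤h) R′)
    where
    cx : c x ≡ nothing
    cx = Agrees-absent m c ag mx
  ... | false | ofⁿ v≰h =
    put-spec high {wp (findBorderline high ⨾ shrink) Q} {rB = nothing} {rS = nothing} R cx λ R₁ →
    findBorderline-spec high {wp shrink Q} {rE = nothing} {rB = nothing} R₁
      (λ none → k (consistent ag₁ (subst (HighCount c₁) (ℕ.+-comm 1 h) hc₁)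
        (subst (Bounded c₁) (ℕ.+-comm 1 h) (Bounded-suc c₁ bd₁ none)) R₁))
      λ y c₁y → take-spec high {wp (basic (move valueʳ (reg indexʳ)) ⨾ put low) Q}
                  {rP = nothing} {rS = nothing} R₁ c₁y λ R₂ →
        put-spec low {Q} {rB = nothing} {rS = nothing} R₂ (update-at c₁ y) λ R₃ → k (consistent
          (Agrees-move (m [ x ↦ᵐ just v ]) c₁ ag₁ c₁y) (demoted y c₁y)
          (Bounded-put (c₁ [ y ↦ nothing ]) (Bounded-drop c₁ bd₁) ≤-refl) R₃)
    where
    cx : c x ≡ nothing
    cx = Agrees-absent m c ag mx
    c₁ : U → Place
    c₁ = c [ x ↦ just (high , v) ]
    ag₁ : Agrees (m [ x ↦ᵐ just v ]) c₁
    ag₁ = Agrees-update m c ag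
    hc₁ : HighCount c₁ (suc h)
    hc₁ = HighCount-put c (¬high-nothing cx) hc
    bd₁ : Bounded c₁ h
    bd₁ = Bounded-put c bd (ℕ.<⇒≤ (ℕ.≰⇒> v≰h))
    demoted : ∀ y → c₁ y ≡ just (high , h) → HighCount ((c₁ [ y ↦ nothing ]) [ y ↦ just (low , h) ]) h
    demoted y c₁y with HighCount-drop c₁ (h , c₁y) hc₁
    ... | _ , refl , hc₂ = HighCount-same (c₁ [ y ↦ nothing ]) (¬high-nothing (update-at c₁ y)) (¬high-low refl) hc₂

  remove-spec : ∀ {Q : Machine → Set} {rV rI rE rW rB rP rS ds m x} →
    let σ = ⟨ just (el x) ∷ rV ∷ rI ∷ rE ∷ rW ∷ rB ∷ rP ∷ rS ∷ [] , ds ⟩ in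
    Consistent m σ → m x ≢ nothing →
    (∀ {rI′ rE′ rW′ rB′ rP′ rS′ ds′} →
      let σ′ = ⟨ just (el x) ∷ rV ∷ rI′ ∷ rE′ ∷ rW′ ∷ rB′ ∷ rP′ ∷ rS′ ∷ [] , ds′ ⟩ in
      Consistent (m [ x ↦ᵐ nothing ]) σ′ → Q σ′) →
    wp removeProg Q σ
  remove-spec {Q} {ds = DH ∷ _ ∷ _ ∷ _ ∷ []} {m = m} {x} record
    { h = h ; c = c ; index = refl ; agrees = ag ; highCount = hc ; bounded = bd ; represents = R } mx k
    with c x in cx | DH (el x) | stores R high x
  ... | nothing         | _ | _    = contradiction (trans (sym (ag x)) (cong (Maybe.map proj₂) cx)) mx
  ... | just (low , _)  | _ | refl =
    take-spec low {Q} {rP = nothing} {rS = nothing} R cx λ R′ → k (consistent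
      (Agrees-update m c ag) (HighCount-same c (¬high-low cx) (¬high-nothing refl) hc) (Bounded-drop c bd) R′)
  ... | just (high , v) | _ | refl with HighCount-drop c (v , cx) hc
  ...   | h₀ , refl , hc₁ =
    take-spec high {wp (findBorderline low ⨾ grow) Q} {rP = nothing} {rS = nothing} R cx λ R₁ →
    findBorderline-spec low {wp grow Q} {rE = nothing} {rB = nothing} R₁
      (λ none → k (consistent ag₁ hc₁ (Bounded-pred c₁ bd₁ none) R₁))
      λ y c₁y → take-spec low {wp (basic (move valueʳ (reg indexʳ)) ⨾ put high) Q}
                  {rP = nothing} {rS = nothing} R₁ c₁y λ R₂ →
        put-spec high {Q} {rB = nothing} {rS = nothing} R₂ (update-at c₁ y) λ R₃ → k (consistent
          (Agrees-move (m [ x ↦ᵐ nothing ]) c₁ ag₁ c₁y) (promoted y c₁y)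
          (Bounded-put (c₁ [ y ↦ nothing ]) (Bounded-drop c₁ bd₁) ≤-refl) R₃)
    where
    c₁ : U → Place
    c₁ = c [ x ↦ nothing ]
    ag₁ : Agrees (m [ x ↦ᵐ nothing ]) c₁
    ag₁ = Agrees-update m c ag
    bd₁ : Bounded c₁ (suc h₀)
    bd₁ = Bounded-drop c bd
    promoted : ∀ y → c₁ y ≡ just (low , suc h₀) →
      HighCount ((c₁ [ y ↦ nothing ]) [ y ↦ just (high , suc h₀) ]) (suc h₀)
    promoted y c₁y = HighCount-put (c₁ [ y ↦ nothing ]) (¬high-nothing (update-at c₁ y))
      (HighCount-same c₁ (¬high-low c₁y) (¬high-nothing refl) hc₁)

hIndexStructure : DataStructure
hIndexStructure = record
  { #regs = 8 ; #dicts = 4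
  ; argX = argXʳ ; argV = argVʳ ; outIndex = indexʳ
  ; outH = sideᵈ high ; outRest = sideᵈ low
  ; initProg   = basic (move indexʳ (lit 0))
  ; insertProg = addProg
  ; deleteProg = removeProg
  ; changeProg = removeProg ⨾ addProg
  }

module Maintenance {U : Set} (_≟_ : DecidableEquality U) where
  open Semantics _≟_
  open WeakestPrecondition _≟_ {8} {4}
  open LinkedBuckets _≟_ using (empty-Linked)
  open Placement _≟_
  open Correctness _≟_
  open Consistent
  open Represents
  open FunctionUpdate {B = Maybe ℕ} _≟_
  open Behaviour hIndexStructure _≟_
  open DecMembership _≟_ using (_∈?_)

  record Models (S : List U) (f : U → ℕ) (m : U → Maybe ℕ) : Set where
    field
      inside  : ∀ {y} → y ∈ S → m y ≡ just (f y)
      outside : ∀ {y} → y ∉ S → m y ≡ nothing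

  open Models

  record Invariant (S : List U) (f : U → ℕ) (σ : DSState) : Set where
    field
      S-unique     : Unique S
      content      : U → Maybe ℕ
      models       : Models S f content
      isConsistent : Consistent content σ

  open Invariant

  Models-insert : ∀ {S f m x v} → Models S f m → Models (x ∷ S) (assign _≟_ x v f) (m [ x ↦ just v ])
  Models-insert {S} {f} {m} {x} {v} M = record { inside = inside′ ; outside = outside′ }
    where
    inside′ : ∀ {y} → y ∈ x ∷ S → (m [ x ↦ just v ]) y ≡ just (assign _≟_ x v f y)
    inside′ {y} y∈ with x ≟ y
    inside′ y∈          | yes _  = refl
    inside′ (here refl) | no x≢x = contradiction refl x≢x
    inside′ (there y∈)  | no _   = inside M y∈
    outside′ : ∀ {y} → y ∉ x ∷ S → (m [ x ↦ just v ]) y ≡ nothing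
    outside′ {y} y∉ with x ≟ y
    ... | yes refl = contradiction (here refl) y∉
    ... | no  _    = outside M (y∉ ∘ there)

  Models-delete : ∀ {S f m x} → Models S f m →
    Models (updateSet _≟_ (delete x) S) f (m [ x ↦ nothing ])
  Models-delete {S} {f} {m} {x} M = record { inside = inside′ ; outside = outside′ }
    where
    x≢? = λ y → ¬? (x ≟ y)
    inside′ : ∀ {y} → y ∈ filter x≢? S → (m [ x ↦ nothing ]) y ≡ just (f y)
    inside′ y∈ with ∈-filter⁻ x≢? {xs = S} y∈
    ... | y∈S , x≢y = trans (update-off m x≢y) (inside M y∈S)
    outside′ : ∀ {y} → y ∉ filter x≢? S → (m [ x ↦ nothing ]) y ≡ nothing
    outside′ {y} y∉ with x ≟ y
    ... | yes _   = refl
    ... | no  x≢y = outside M λ y∈ → y∉ (∈-filter⁺ x≢? y∈ x≢y)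

  Models-change : ∀ {S f m x v} → x ∈ S → Models S f m →
    Models S (assign _≟_ x v f) ((m [ x ↦ nothing ]) [ x ↦ just v ])
  Models-change {S} {f} {m} {x} {v} x∈ M = record { inside = inside′ ; outside = outside′ }
    where
    m′ : U → Maybe ℕ
    m′ = (m [ x ↦ nothing ]) [ x ↦ just v ]
    inside′ : ∀ {y} → y ∈ S → m′ y ≡ just (assign _≟_ x v f y)
    inside′ {y} y∈ with x ≟ y
    ... | yes _ = refl
    ... | no  _ = inside M y∈
    outside′ : ∀ {y} → y ∉ S → m′ y ≡ nothing
    outside′ {y} y∉ with x ≟ y
    ... | yes refl = contradiction x∈ y∉
    ... | no  _    = outside M y∉

  present : ∀ {S f m x} → Models S f m → x ∈ S → m x ≢ nothing
  present M x∈ mx = nothing≢just mx (inside M x∈)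

  Invariant-initially : ∀ {f} → wp (DataStructure.initProg hIndexStructure) (Invariant [] f) blank
  Invariant-initially = record
    { S-unique = []
    ; content = λ _ → nothing
    ; models = record { inside = λ () ; outside = λ _ → refl }
    ; isConsistent = record
      { h = 0
      ; c = λ _ → nothing
      ; index = refl
      ; agrees = λ _ → refl
      ; highCount = [] , [] , refl , mk⇔ (λ ()) (λ ())
      ; bounded = λ _ ()
      ; represents = record
        { stores = λ { high _ → refl ; low _ → refl }
        ; no-num = λ { high _ → refl ; low _ → refl }
        ; linked = empty-Linked
        }
      }
    }

  Invariant-update : ∀ {S f σ} → Invariant S f σ → (u : Update U) → Valid u S →
    wp (program u) (Invariant (updateSet _≟_ u S) (updateFun _≟_ u f)) (load u σ)
  Invariant-update {σ = ⟨ _ ∷ _ ∷ _ ∷ _ ∷ _ ∷ _ ∷ _ ∷ _ ∷ [] , _ ⟩} I (insert x v) x∉ =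
    add-spec (reload (isConsistent I)) (outside (models I) x∉) λ C → record
      { S-unique = All.tabulate (λ { y∈ refl → x∉ y∈ }) ∷ S-unique I
      ; models = Models-insert (models I) ; isConsistent = C }
  Invariant-update {σ = ⟨ _ ∷ _ ∷ _ ∷ _ ∷ _ ∷ _ ∷ _ ∷ _ ∷ [] , _ ⟩} I (delete x) x∈ =
    remove-spec (reload (isConsistent I)) (present (models I) x∈) λ C → record
      { S-unique = filter⁺ (λ y → ¬? (x ≟ y)) (S-unique I)
      ; models = Models-delete (models I) ; isConsistent = C }
  Invariant-update {σ = ⟨ _ ∷ _ ∷ _ ∷ _ ∷ _ ∷ _ ∷ _ ∷ _ ∷ [] , _ ⟩} I (change x v) x∈ =
    remove-spec (reload (isConsistent I)) (present (models I) x∈) λ C →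
    add-spec C (update-at (content I) x) λ C′ → record
      { S-unique = S-unique I ; models = Models-change x∈ (models I) ; isConsistent = C′ }

  Invariant⇒StoresHPartition : ∀ {S f σ} → Invariant S f σ → StoresHPartition S f σ
  Invariant⇒StoresHPartition {S} {f} {σ} I with isConsistent I
  ... | record { h = h ; c = c ; index = idx ; agrees = ag ; highCount = H , uniq , refl , mem
               ; bounded = bd ; represents = R } = record
    { h = length H ; h-stored = idx ; h-index = hIndex ; H = H ; K = K
    ; H-stored = H-keys ; K-stored = K-keys
    ; h-partition = record
      { H-unique = uniq ; H⊆S = H⊆S ; H-size = hIndex ; H-large = H-large
      ; K-unique = filter⁺ ∉H? (S-unique I)
      ; K-complement = λ x → mk⇔ (∈-filter⁻ ∉H? {xs = S}) λ (x∈S , x∉H) → ∈-filter⁺ ∉H? x∈S x∉H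
      }
    }
    where
    M = models I
    ∉H? = λ x → ¬? (x ∈? H)
    K : List U
    K = filter ∉H? S

    placed⇒∈ : ∀ {x s v} → c x ≡ just (s , v) → x ∈ S × v ≡ f x
    placed⇒∈ {x} cx with x ∈? S
    ... | yes x∈ = x∈ , just-injective (trans (trans (sym (cong (Maybe.map proj₂) cx)) (ag x)) (inside M x∈))
    ... | no  x∉ = contradiction (trans (sym (cong (Maybe.map proj₂) cx)) (ag x))
                     (nothing≢just (outside M x∉) ∘ sym)

    H⊆S : H ⊆ S
    H⊆S x∈H = proj₁ (placed⇒∈ (proj₂ (Equivalence.to mem x∈H)))

    H-large : ∀ {x} → x ∈ H → length H ≤ f x
    H-large {x} x∈H with Equivalence.to mem x∈H
    ... | v , cx = subst (length H ≤_) (proj₂ (placed⇒∈ cx)) (bd x cx)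

    low-∉H : ∀ {x v} → c x ≡ just (low , v) → x ∉ H
    low-∉H cx x∈H = ¬high-low cx (Equivalence.to mem x∈H)

    outside-H : ∀ {x} → x ∈ S → x ∉ H → c x ≡ just (low , f x)
    outside-H {x} x∈S x∉H with c x in cx
    ... | nothing         = contradiction (trans (trans (cong (Maybe.map proj₂) (sym cx)) (ag x)) (inside M x∈S)) λ ()
    ... | just (high , v) = contradiction (Equivalence.from mem (v , cx)) x∉H
    ... | just (low  , v) = cong (λ w → just (low , w)) (proj₂ (placed⇒∈ cx))

    hIndex : IsHIndex S f (length H)
    hIndex = record
      { attained = H , uniq , H⊆S , refl , H-large
      ; largest = largest
      }
      where
      largest : ∀ k → HasLargeSubset S f k → k ≤ length H
      largest k (T , uniqT , T⊆S , refl , T-large) with length T ℕ.≤? length H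
      ... | yes k≤ = k≤
      ... | no  k≰ = Unique-⊆⇒length≤ uniqT uniq T⊆H
        where
        T⊆H : T ⊆ H
        T⊆H {x} x∈T with x ∈? H
        ... | yes x∈H = x∈H
        ... | no  x∉H = contradiction (≤-trans (T-large x∈T) (bd x (outside-H (T⊆S x∈T) x∉H))) k≰

    H-keys : HasKeys (lookup (dicts σ) (sideᵈ high)) H
    H-keys (num n) = mk⇔ (λ (_ , eq) → contradiction eq (nothing≢just (no-num R high n))) λ { (_ , () , _) }
    H-keys (el x) = mk⇔ to λ { (_ , refl , x∈H) → from x∈H }
      where
      to : (∃[ v ] lookup (dicts σ) (sideᵈ high) (el x) ≡ just v) → ∃[ y ] el x ≡ el y × y ∈ H
      to (_ , eq) with c x in cx | trans (sym (stores R high x)) eq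
      ... | just (high , v) | _ = x , refl , Equivalence.from mem (v , cx)
      from : x ∈ H → ∃[ v ] lookup (dicts σ) (sideᵈ high) (el x) ≡ just v
      from x∈H with Equivalence.to mem x∈H
      ... | v , cx = num v , trans (stores R high x) (cong (entry high) cx)

    K-keys : HasKeys (lookup (dicts σ) (sideᵈ low)) K
    K-keys (num n) = mk⇔ (λ (_ , eq) → contradiction eq (nothing≢just (no-num R low n))) λ { (_ , () , _) }
    K-keys (el x) = mk⇔ to λ { (_ , refl , x∈K) → from x∈K }
      where
      to : (∃[ v ] lookup (dicts σ) (sideᵈ low) (el x) ≡ just v) → ∃[ y ] el x ≡ el y × y ∈ K
      to (_ , eq) with c x in cx | trans (sym (stores R low x)) eq
      ... | just (low , v) | _ = x , refl , ∈-filter⁺ ∉H? (proj₁ (placed⇒∈ cx)) (low-∉H cx)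
      from : x ∈ K → ∃[ v ] lookup (dicts σ) (sideᵈ low) (el x) ≡ just v
      from x∈K with ∈-filter⁻ ∉H? {xs = S} x∈K
      ... | x∈S , x∉H = num (f x) , trans (stores R low x) (cong (entry low) (outside-H x∈S x∉H))

  wp-Exec : ∀ p Q {σ σ′ t q} → wp p Q σ → Exec p σ σ′ t q → Q σ′
  wp-Exec p Q w x with wp-sound _≟_ p w
  ... | _ , _ , _ , x′ , _ , _ , post with Exec-deterministic x x′
  ...   | refl , _ , _ = post

  Reachable⇒Invariant : ∀ {S f σ} → Reachable S f σ → Invariant S f σ
  Reachable⇒Invariant (start {f} x) = wp-Exec _ (Invariant [] f) Invariant-initially x
  Reachable⇒Invariant (update r u valid x) =
    wp-Exec (program u) _ (Invariant-update (Reachable⇒Invariant r) u valid) x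

  wp⇒HaltsWithin : ∀ p Q {c σ} → size p ≤ c → wp p Q σ → HaltsWithin c p σ
  wp⇒HaltsWithin p Q size≤c w with wp-sound _≟_ p w
  ... | σ′ , t , q , x , t≤ , q≤ , _ = σ′ , t , q , x , ≤-trans t≤ size≤c , ≤-trans q≤ size≤c

  maintains : MaintainsHPartition (size (removeProg ⨾ addProg))
  maintains = record
    { initialises = wp⇒HaltsWithin _ (Invariant [] λ _ → 0) (s≤s z≤n) Invariant-initially
    ; responds = λ r u valid → wp⇒HaltsWithin (program u) _ (size-program u)
                   (Invariant-update (Reachable⇒Invariant r) u valid)
    ; correct = Invariant⇒StoresHPartition ∘ Reachable⇒Invariant
    }
    where
    size-program : ∀ u → size (program u) ≤ size (removeProg ⨾ addProg)
    size-program (insert _ _) = ℕ.m≤n+m (size addProg) (size removeProg)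
    size-program (delete _)   = ℕ.m≤m+n (size removeProg) (size addProg)
    size-program (change _ _) = ≤-refl

theorem1 : Σ[ DS ∈ DataStructure ] Σ[ c ∈ ℕ ] ((U : Set) (_≟_ : DecidableEquality U) → Behaviour.MaintainsHPartition DS _≟_ c)
theorem1 = hIndexStructure , size (removeProg ⨾ addProg) , λ U _≟_ → Maintenance.maintains _≟_
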